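{- For every integer $n\geq 2$ and every $i\in\{1,\ldots,n-1\}$, there exists a $3i$-eigenfunction $f$ of the Hamming graph $H(n,3)$ such that $\mathrm{SND}(f)=2$.
   Context: The Hamming graph $H(n,q)$ has vertex set $\mathbb{Z}_q^n$, two vertices being adjacent iff they differ in exactly one coordinate. For a graph $G$ with vertex set $V$ and a real number $\lambda$, a $\lambda$-eigenfunction of $G$ is a function $f:V\to\mathbb{R}$ with $f\not\equiv 0$ such that $\lambda f(x)=\sum_{y\in N(x)}(f(x)-f(y))$ for every $x\in V$, where $N(x)$ is the set of neighbours of $x$. A positive (negative) strong nodal domain of $f$ is a maximal connected induced subgraph of $G$ on vertices $x$ with $f(x)>0$ ($f(x)<0$); $\mathrm{SND}(f)$ denotes the total number of strong nodal domains of $f$. -}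

module Defs where

open import Data.Nat using (ℕ; zero; suc)
open import Data.Fin using (Fin)
import Data.Fin as Fin
open import Data.Fin.Base using () 
open import Data.Vec using (Vec; []; _∷_)
open import Data.List using (List; []; _∷_; map; concatMap; filter; foldr; allFin)
open import Data.Integer using (ℤ; 0ℤ; _+_; _-_; _*_; _<_)
open import Data.Product using (Σ; ∃; _×_)
open import Data.Sum using (_⊎_)
open import Relation.Nullary using (¬_; yes; no; Dec)
open import Relation.Binary.PropositionalEquality using (_≡_)
import Data.Nat as ℕ

-- Vertices of the Hamming graph H(n,q): words of length n over Z_q (= Fin q).
Vertex : ℕ → ℕ → Set
Vertex n q = Vec (Fin q) n

-- Hamming distance: number of coordinates in which two words differ.
hdist : ∀ {n q} → Vertex n q → Vertex n q → ℕ
hdist [] [] = 0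
hdist (a ∷ x) (b ∷ y) with a Fin.≟ b
... | yes _ = hdist x y
... | no  _ = suc (hdist x y)

-- Adjacency in H(n,q): differ in exactly one coordinate.
Adjacent : ∀ {n q} → Vertex n q → Vertex n q → Set
Adjacent x y = hdist x y ≡ 1

adjacent? : ∀ {n q} (x y : Vertex n q) → Dec (Adjacent x y)
adjacent? x y = hdist x y ℕ.≟ 1

-- Enumeration of all vertices of H(n,q).
allVertices : ∀ n q → List (Vertex n q)
allVertices zero    q = [] ∷ []
allVertices (suc n) q = concatMap (λ v → map (λ a → a ∷ v) (allFin q)) (allVertices n q)

-- Neighbourhood N(x).
neighbours : ∀ {n q} → Vertex n q → List (Vertex n q)
neighbours {n} {q} x = filter (adjacent? x) (allVertices n q)

sumℤ : List ℤ → ℤ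
sumℤ = foldr _+_ 0ℤ

-- λ-eigenfunction (integer-valued; see NOTES.md):
-- f ≢ 0 and λ f(x) = Σ_{y ∈ N(x)} (f(x) - f(y)) for all x.
IsEigenfunction : ∀ n q → ℤ → (Vertex n q → ℤ) → Set
IsEigenfunction n q λ' f =
  (∃ λ x → ¬ (f x ≡ 0ℤ)) ×
  (∀ x → λ' * f x ≡ sumℤ (map (λ y → f x - f y) (neighbours x)))

-- Same strict sign (both positive or both negative).
SameSign : ℤ → ℤ → Set
SameSign a b = (0ℤ < a × 0ℤ < b) ⊎ (a < 0ℤ × b < 0ℤ)

-- x and y lie in the same strong nodal domain of f: there is a walk from x to y
-- in G all of whose vertices have the same strict sign as f(x)
-- (i.e. a walk in the induced subgraph on {f>0} or on {f<0}).
data SameDomain {n q} (f : Vertex n q → ℤ) : Vertex n q → Vertex n q → Set where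
  here : ∀ {x} → ¬ (f x ≡ 0ℤ) → SameDomain f x x
  step : ∀ {x y z} → Adjacent x y → SameSign (f x) (f y) →
         SameDomain f y z → SameDomain f x z

-- SND(f) = k: the strong nodal domains (equivalence classes of SameDomain on
-- the nonzero vertices) are exactly k many, i.e. there are k vertices lying in
-- pairwise distinct strong nodal domains such that every vertex where f is
-- nonzero lies in the domain of one of them.
SNDIs : ∀ {n q} → (Vertex n q → ℤ) → ℕ → Set
SNDIs {n} {q} f k =
  Σ (Fin k → Vertex n q) λ r →
    (∀ j → ¬ (f (r j) ≡ 0ℤ)) ×
    (∀ j j' → SameDomain f (r j) (r j') → j ≡ j') ×
    (∀ x → ¬ (f x ≡ 0ℤ) → ∃ λ j → SameDomain f x (r j))

-- Write a vertex of H(n, 3) as a ∷ b ∷ z and let t z ∈ ℤ/3 be the sum of the first i − 1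
-- coordinates of z. With u = (2, −1, −1) the function f (a ∷ b ∷ z) = u (a + t z) + u (b + t z)
-- is a sum of two plane waves, each involving i coordinates, hence a 3i-eigenfunction. It takes
-- the values 4, 1, −2 and is positive exactly when a + t z = 0 or b + t z = 0. Over a fixed tail z
-- the pairs (a, b) form K₃ □ K₃, in which the positive pairs form a cross and the negative pairs a
-- 2 × 2 square, both connected; for adjacent tails z, z′ some pair (a, b) has the same sign over
-- z and over z′. Since H(n − 2, 3) is connected, each sign class is a single strong nodal domain.
module Submission where

open import Defs
open import Data.Bool using (Bool; true; false; if_then_else_)
open import Data.Empty using (⊥-elim)
open import Data.Fin using (Fin; zero; suc; _≟_)
open import Data.Fin.Patterns using (0F; 1F; 2F)
open import Data.Fin.Properties using (all?; any?)
open import Data.Fin.Subset using (Subset; inside; outside; ∣_∣; ⊥)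
open import Data.Fin.Subset.Properties using (∣⊥∣≡0)
open import Data.Integer as ℤ using (ℤ; +_; -[1+_]; 0ℤ; -1ℤ; _+_; _-_; +<+; -<+; _<?_)
open import Data.Integer.Properties
  using (+-identityˡ; +-identityʳ; +-assoc; +-inverseʳ; *-distribˡ-+; pos-*; <-irrefl; <-asym)
open import Data.Integer.Tactic.RingSolver using (solve-∀)
open import Data.List using (List; []; _∷_; map; filter; concatMap; allFin; _++_)
open import Data.List.Properties using (map-cong; map-∘; map-tabulate)
open import Data.Nat as ℕ using (ℕ; zero; suc; _≤_; _<_; _*_; _≡ᵇ_; s≤s; z≤n)
open import Data.Nat.Properties using (m≤n⇒∃[o]m+o≡n)
open import Data.Product using (Σ; ∃; ∃₂; _×_; _,_; swap)
open import Data.Sign as Sign using (Sign)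
open import Data.Sum as Sum using (_⊎_; inj₁; inj₂)
open import Data.Vec using ([]; _∷_; replicate)
open import Function using (_∘_)
open import Relation.Binary.Definitions using (Symmetric)
open import Relation.Binary.Construct.Closure.ReflexiveTransitive
  using (Star; ε; _◅_; _◅◅_; gmap; reverse)
open import Relation.Binary.PropositionalEquality
  using (_≡_; _≢_; refl; sym; trans; cong; cong₂; subst; subst₂; module ≡-Reasoning)
open import Relation.Nullary using (Dec; yes; no; does)
open import Relation.Nullary.Decidable using (toWitness; _×-dec_)

∑ : {A : Set} → (A → ℤ) → List A → ℤ
∑ φ xs = sumℤ (map φ xs)

∑-cong : {A : Set} {φ ψ : A → ℤ} → (∀ x → φ x ≡ ψ x) → ∀ xs → ∑ φ xs ≡ ∑ ψ xs
∑-cong φ≗ψ xs = cong sumℤ (map-cong φ≗ψ xs)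

∑-zero : {A : Set} (xs : List A) → ∑ (λ _ → 0ℤ) xs ≡ 0ℤ
∑-zero []       = refl
∑-zero (_ ∷ xs) = trans (+-identityˡ _) (∑-zero xs)

∑-+ : {A : Set} (φ ψ : A → ℤ) (xs : List A) → ∑ (λ x → φ x + ψ x) xs ≡ ∑ φ xs + ∑ ψ xs
∑-+ φ ψ []       = refl
∑-+ φ ψ (x ∷ xs) = trans (cong (_+_ (φ x + ψ x)) (∑-+ φ ψ xs)) (interchange (φ x) (ψ x) _ _)
  where
  interchange : ∀ a b c d → (a + b) + (c + d) ≡ (a + c) + (b + d)
  interchange = solve-∀

∑-++ : {A : Set} (φ : A → ℤ) (xs ys : List A) → ∑ φ (xs ++ ys) ≡ ∑ φ xs + ∑ φ ys
∑-++ φ []       ys = sym (+-identityˡ _)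
∑-++ φ (x ∷ xs) ys = trans (cong (_+_ (φ x)) (∑-++ φ xs ys)) (sym (+-assoc (φ x) _ _))

∑-concatMap : {A B : Set} (φ : B → ℤ) (g : A → List B) (xs : List A) →
              ∑ φ (concatMap g xs) ≡ ∑ (λ x → ∑ φ (g x)) xs
∑-concatMap φ g []       = refl
∑-concatMap φ g (x ∷ xs) = trans (∑-++ φ (g x) _) (cong (_+_ (∑ φ (g x))) (∑-concatMap φ g xs))

∑-filter : {A : Set} {P : A → Set} (P? : ∀ x → Dec (P x)) (φ : A → ℤ) (xs : List A) →
           ∑ φ (filter P? xs) ≡ ∑ (λ x → if does (P? x) then φ x else 0ℤ) xs
∑-filter P? φ []       = refl
∑-filter P? φ (x ∷ xs) with does (P? x)
... | true  = cong (_+_ (φ x)) (∑-filter P? φ xs)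
... | false = trans (∑-filter P? φ xs) (sym (+-identityˡ _))

∑-if : {A : Set} (c : Bool) (φ : A → ℤ) (xs : List A) →
       ∑ (λ x → if c then φ x else 0ℤ) xs ≡ (if c then ∑ φ xs else 0ℤ)
∑-if true  φ xs = refl
∑-if false φ xs = ∑-zero xs

∑-allFin-suc : ∀ {q} (h : Fin (suc q) → ℤ) → ∑ h (allFin (suc q)) ≡ h zero + ∑ (h ∘ suc) (allFin q)
∑-allFin-suc h = cong (λ hs → h zero + sumℤ hs)
  (trans (map-tabulate suc h) (sym (map-tabulate (λ b → b) (h ∘ suc))))

δ : ∀ {q} → Fin q → (Fin q → ℤ) → Fin q → ℤ
δ a h b = if does (a ≟ b) then h b else 0ℤ

∑-δ : ∀ {q} (a : Fin q) (h : Fin q → ℤ) → ∑ (δ a h) (allFin q) ≡ h a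
∑-δ {suc q} zero h =
  trans (∑-allFin-suc (δ zero h)) (trans (cong (_+_ (h zero)) (∑-zero (allFin q))) (+-identityʳ _))
∑-δ (suc a) h = trans (∑-allFin-suc (δ (suc a) h)) (trans (+-identityˡ _) (∑-δ a (h ∘ suc)))

-- The Laplacian of H(n, q)

laplacian : ∀ {n q} → (Vertex n q → ℤ) → Vertex n q → ℤ
laplacian f x = ∑ (λ y → f x - f y) (neighbours x)

laplacian-cong : ∀ {n q} {f g : Vertex n q → ℤ} → (∀ y → f y ≡ g y) → ∀ x →
                 laplacian f x ≡ laplacian g x
laplacian-cong f≗g x = ∑-cong (λ y → cong₂ _-_ (f≗g x) (f≗g y)) (neighbours x)

laplacian-+ : ∀ {n q} (f g : Vertex n q → ℤ) x →
              laplacian (λ y → f y + g y) x ≡ laplacian f x + laplacian g x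
laplacian-+ f g x =
  trans (∑-cong (λ y → regroup (f x) (g x) (f y) (g y)) (neighbours x)) (∑-+ _ _ (neighbours x))
  where
  regroup : ∀ a b c d → a + b - (c + d) ≡ (a - c) + (b - d)
  regroup = solve-∀

∑-allVertices-suc : ∀ {n q} (φ : Vertex (suc n) q → ℤ) →
  ∑ φ (allVertices (suc n) q) ≡ ∑ (λ v → ∑ (λ b → φ (b ∷ v)) (allFin q)) (allVertices n q)
∑-allVertices-suc {n} {q} φ = trans (∑-concatMap φ _ (allVertices n q))
  (∑-cong (λ v → cong sumℤ (sym (map-∘ (allFin q)))) (allVertices n q))

∑-hdist≡0 : ∀ {n q} (z : Vertex n q) (G : Vertex n q → ℤ) →
            ∑ (λ v → if hdist z v ≡ᵇ 0 then G v else 0ℤ) (allVertices n q) ≡ G z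
∑-hdist≡0 []      G = +-identityʳ (G [])
∑-hdist≡0 {suc n} {q} (c ∷ z) G = begin
  ∑ (λ v → if hdist (c ∷ z) v ≡ᵇ 0 then G v else 0ℤ) (allVertices (suc n) q)
    ≡⟨ ∑-allVertices-suc {n} _ ⟩
  ∑ (λ v → ∑ (λ b → if hdist (c ∷ z) (b ∷ v) ≡ᵇ 0 then G (b ∷ v) else 0ℤ) (allFin q))
    (allVertices n q)
    ≡⟨ ∑-cong (λ v → ∑-cong (λ b → sameHead b v) (allFin q)) (allVertices n q) ⟩
  ∑ (λ v → ∑ (δ c (λ b → if hdist z v ≡ᵇ 0 then G (b ∷ v) else 0ℤ)) (allFin q)) (allVertices n q)
    ≡⟨ ∑-cong (λ v → ∑-δ c _) (allVertices n q) ⟩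
  ∑ (λ v → if hdist z v ≡ᵇ 0 then G (c ∷ v) else 0ℤ) (allVertices n q)
    ≡⟨ ∑-hdist≡0 z (G ∘ (c ∷_)) ⟩
  G (c ∷ z) ∎
  where
  open ≡-Reasoning
  sameHead : ∀ b v → (if hdist (c ∷ z) (b ∷ v) ≡ᵇ 0 then G (b ∷ v) else 0ℤ)
                     ≡ δ c (λ b → if hdist z v ≡ᵇ 0 then G (b ∷ v) else 0ℤ) b
  sameHead b v with c ≟ b
  ... | yes _ = refl
  ... | no  _ = refl

laplacian-∷ : ∀ {n q} (f : Vertex (suc n) q → ℤ) (a : Fin q) (z : Vertex n q) →
  laplacian f (a ∷ z) ≡ laplacian (λ w → f (a ∷ w)) z + ∑ (λ b → f (a ∷ z) - f (b ∷ z)) (allFin q)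
laplacian-∷ {n} {q} f a z = begin
  laplacian f (a ∷ z)
    ≡⟨ ∑-filter (adjacent? (a ∷ z)) (λ y → A - f y) (allVertices (suc n) q) ⟩
  ∑ (λ y → if hdist (a ∷ z) y ≡ᵇ 1 then A - f y else 0ℤ) (allVertices (suc n) q)
    ≡⟨ ∑-allVertices-suc {n} _ ⟩
  ∑ (λ v → ∑ (λ b → if hdist (a ∷ z) (b ∷ v) ≡ᵇ 1 then A - f (b ∷ v) else 0ℤ) (allFin q))
    (allVertices n q)
    ≡⟨ ∑-cong (λ v → ∑-cong (λ b → split b v) (allFin q)) (allVertices n q) ⟩
  ∑ (λ v → ∑ (λ b → δ a (viaTail v) b + (if hdist z v ≡ᵇ 0 then viaHead v b else 0ℤ)) (allFin q))
    (allVertices n q)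
    ≡⟨ ∑-cong (λ v → trans (∑-+ _ _ (allFin q))
                       (cong₂ _+_ (∑-δ a (viaTail v)) (∑-if (hdist z v ≡ᵇ 0) (viaHead v) (allFin q))))
              (allVertices n q) ⟩
  ∑ (λ v → viaTail v a + (if hdist z v ≡ᵇ 0 then ∑ (viaHead v) (allFin q) else 0ℤ))
    (allVertices n q)
    ≡⟨ ∑-+ _ _ (allVertices n q) ⟩
  ∑ (λ v → viaTail v a) (allVertices n q)
    + ∑ (λ v → if hdist z v ≡ᵇ 0 then ∑ (viaHead v) (allFin q) else 0ℤ) (allVertices n q)
    ≡⟨ cong₂ _+_ (sym (∑-filter (adjacent? z) (λ v → A - f (a ∷ v)) (allVertices n q)))
                 (∑-hdist≡0 z (λ v → ∑ (viaHead v) (allFin q))) ⟩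
  laplacian (λ w → f (a ∷ w)) z + ∑ (viaHead z) (allFin q)
    ≡⟨ cong (_+_ (laplacian (λ w → f (a ∷ w)) z)) (∑-cong viaHead-self (allFin q)) ⟩
  laplacian (λ w → f (a ∷ w)) z + ∑ (λ b → A - f (b ∷ z)) (allFin q) ∎
  where
  open ≡-Reasoning
  A : ℤ
  A = f (a ∷ z)
  viaTail viaHead : Vertex n q → Fin q → ℤ
  viaTail v b = if hdist z v ≡ᵇ 1 then A - f (b ∷ v) else 0ℤ
  viaHead v b = if does (a ≟ b) then 0ℤ else A - f (b ∷ v)
  -- a ∷ z and b ∷ v are adjacent iff either b = a and z, v are adjacent, or b ≠ a and v = z.
  split : ∀ b v → (if hdist (a ∷ z) (b ∷ v) ≡ᵇ 1 then A - f (b ∷ v) else 0ℤ)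
                  ≡ δ a (viaTail v) b + (if hdist z v ≡ᵇ 0 then viaHead v b else 0ℤ)
  split b v with a ≟ b
  split b v | yes _ with hdist z v
  ... | 0           = refl
  ... | 1           = sym (+-identityʳ _)
  ... | suc (suc _) = refl
  split b v | no _ with hdist z v
  ... | 0           = sym (+-identityˡ _)
  ... | 1           = refl
  ... | suc (suc _) = refl
  viaHead-self : ∀ b → viaHead z b ≡ A - f (b ∷ z)
  viaHead-self b with a ≟ b
  ... | yes refl = sym (+-inverseʳ A)
  ... | no  _    = refl

-- Plane waves on H(n, 3)

infixl 6 _⊕_ _⊖_

_⊕_ : Fin 3 → Fin 3 → Fin 3
0F ⊕ b  = b
1F ⊕ 0F = 1F
1F ⊕ 1F = 2F
1F ⊕ 2F = 0F
2F ⊕ 0F = 2F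
2F ⊕ 1F = 0F
2F ⊕ 2F = 1F

_⊖_ : Fin 3 → Fin 3 → Fin 3
a ⊖ 0F = a
a ⊖ 1F = a ⊕ 2F
a ⊖ 2F = a ⊕ 1F

⊕-comm : ∀ a b → a ⊕ b ≡ b ⊕ a
⊕-comm = toWitness {a? = all? λ a → all? λ b → a ⊕ b ≟ b ⊕ a} _

⊖-⊕-cancel : ∀ a b → a ⊖ b ⊕ b ≡ a
⊖-⊕-cancel = toWitness {a? = all? λ a → all? λ b → a ⊖ b ⊕ b ≟ a} _

⊕-⊖-cancel : ∀ a b → a ⊕ b ⊖ b ≡ a
⊕-⊖-cancel = toWitness {a? = all? λ a → all? λ b → a ⊕ b ⊖ b ≟ a} _

Balanced : (Fin 3 → ℤ) → Set
Balanced v = ∑ v (allFin 3) ≡ 0ℤ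

balanced-⊕ʳ : ∀ v → Balanced v → ∀ a → Balanced (λ b → v (b ⊕ a))
balanced-⊕ʳ v bal 0F = bal
balanced-⊕ʳ v bal 1F = trans (rotate (v 0F) (v 1F) (v 2F)) bal
  where
  rotate : ∀ x y z → y + (z + (x + 0ℤ)) ≡ x + (y + (z + 0ℤ))
  rotate = solve-∀
balanced-⊕ʳ v bal 2F = trans (rotate (v 0F) (v 1F) (v 2F)) bal
  where
  rotate : ∀ x y z → z + (x + (y + 0ℤ)) ≡ x + (y + (z + 0ℤ))
  rotate = solve-∀

balanced-⊕ˡ : ∀ v → Balanced v → ∀ a → Balanced (λ b → v (a ⊕ b))
balanced-⊕ˡ v bal a =
  trans (∑-cong (λ b → cong v (⊕-comm a b)) (allFin 3)) (balanced-⊕ʳ v bal a)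

∑-differences : ∀ w → Balanced w → ∀ c → ∑ (λ b → c - w b) (allFin 3) ≡ + 3 ℤ.* c
∑-differences w bal c = begin
  ∑ (λ b → c - w b) (allFin 3)  ≡⟨ collect c (w 0F) (w 1F) (w 2F) ⟩
  + 3 ℤ.* c - ∑ w (allFin 3)    ≡⟨ cong (λ s → + 3 ℤ.* c - s) bal ⟩
  + 3 ℤ.* c - 0ℤ                ≡⟨ +-identityʳ _ ⟩
  + 3 ℤ.* c                     ∎
  where
  open ≡-Reasoning
  collect : ∀ c x y z → c - x + (c - y + (c - z + 0ℤ)) ≡ + 3 ℤ.* c - (x + (y + (z + 0ℤ)))
  collect = solve-∀

coordinateSum : ∀ {n} → Subset n → Vertex n 3 → Fin 3
coordinateSum []            []      = 0F
coordinateSum (inside ∷ S)  (a ∷ x) = a ⊕ coordinateSum S x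
coordinateSum (outside ∷ S) (a ∷ x) = coordinateSum S x

planeWave-eigen : ∀ {n} (S : Subset n) v → Balanced v → ∀ x →
  laplacian (v ∘ coordinateSum S) x ≡ + (3 * ∣ S ∣) ℤ.* v (coordinateSum S x)
planeWave-eigen []            v bal [] = refl
planeWave-eigen (inside ∷ S)  v bal (a ∷ z) = begin
  laplacian (v ∘ coordinateSum (inside ∷ S)) (a ∷ z)
    ≡⟨ laplacian-∷ (v ∘ coordinateSum (inside ∷ S)) a z ⟩
  laplacian (λ w → v (a ⊕ coordinateSum S w)) z + ∑ (λ b → v (a ⊕ σ) - v (b ⊕ σ)) (allFin 3)
    ≡⟨ cong₂ _+_ (planeWave-eigen S (λ c → v (a ⊕ c)) (balanced-⊕ˡ v bal a) z)
                 (∑-differences (λ b → v (b ⊕ σ)) (balanced-⊕ʳ v bal σ) (v (a ⊕ σ))) ⟩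
  + (3 * ∣ S ∣) ℤ.* v (a ⊕ σ) + + 3 ℤ.* v (a ⊕ σ)
    ≡⟨ cong (λ k → k ℤ.* v (a ⊕ σ) + + 3 ℤ.* v (a ⊕ σ)) (pos-* 3 ∣ S ∣) ⟩
  + 3 ℤ.* + ∣ S ∣ ℤ.* v (a ⊕ σ) + + 3 ℤ.* v (a ⊕ σ)
    ≡⟨ factor (+ ∣ S ∣) (v (a ⊕ σ)) ⟩
  + 3 ℤ.* (+ 1 + + ∣ S ∣) ℤ.* v (a ⊕ σ)
    ≡⟨ cong (λ k → k ℤ.* v (a ⊕ σ)) (sym (pos-* 3 (suc ∣ S ∣))) ⟩
  + (3 * suc ∣ S ∣) ℤ.* v (a ⊕ σ) ∎
  where
  open ≡-Reasoning
  σ : Fin 3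
  σ = coordinateSum S z
  factor : ∀ k x → + 3 ℤ.* k ℤ.* x + + 3 ℤ.* x ≡ + 3 ℤ.* (+ 1 + k) ℤ.* x
  factor = solve-∀
planeWave-eigen (outside ∷ S) v bal (a ∷ z) = begin
  laplacian (v ∘ coordinateSum (outside ∷ S)) (a ∷ z)
    ≡⟨ laplacian-∷ (v ∘ coordinateSum (outside ∷ S)) a z ⟩
  laplacian (v ∘ coordinateSum S) z + ∑ (λ _ → v σ - v σ) (allFin 3)
    ≡⟨ cong₂ _+_ (planeWave-eigen S v bal z)
                 (trans (∑-cong (λ _ → +-inverseʳ (v σ)) (allFin 3)) (∑-zero (allFin 3))) ⟩
  + (3 * ∣ S ∣) ℤ.* v σ + 0ℤ
    ≡⟨ +-identityʳ _ ⟩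
  + (3 * ∣ S ∣) ℤ.* v σ ∎
  where
  open ≡-Reasoning
  σ : Fin 3
  σ = coordinateSum S z

-- Walks in H(n, q)

hdist-refl : ∀ {n q} (x : Vertex n q) → hdist x x ≡ 0
hdist-refl []      = refl
hdist-refl (a ∷ x) with a ≟ a
... | yes _   = hdist-refl x
... | no  a≢a = ⊥-elim (a≢a refl)

hdist-sym : ∀ {n q} (x y : Vertex n q) → hdist x y ≡ hdist y x
hdist-sym []      []      = refl
hdist-sym (a ∷ x) (b ∷ y) with a ≟ b | b ≟ a
... | yes _    | yes _    = hdist-sym x y
... | yes refl | no b≢a   = ⊥-elim (b≢a refl)
... | no a≢b   | yes refl = ⊥-elim (a≢b refl)
... | no _     | no _     = cong suc (hdist-sym x y)

Adjacent-sym : ∀ {n q} (x y : Vertex n q) → Adjacent x y → Adjacent y x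
Adjacent-sym x y adj = trans (hdist-sym y x) adj

Adjacent-∷ : ∀ {n q} (a : Fin q) {x y : Vertex n q} → Adjacent x y → Adjacent (a ∷ x) (a ∷ y)
Adjacent-∷ a adj with a ≟ a
... | yes _   = adj
... | no  a≢a = ⊥-elim (a≢a refl)

change-head : ∀ {n q} (a b : Fin q) (x : Vertex n q) → a ∷ x ≡ b ∷ x ⊎ Adjacent (a ∷ x) (b ∷ x)
change-head a b x with a ≟ b
... | yes refl = inj₁ refl
... | no  _    = inj₂ (cong suc (hdist-refl x))

Hamming-connected : ∀ {n q} (x y : Vertex n q) → Star Adjacent x y
Hamming-connected []      []      = ε
Hamming-connected (a ∷ x) (b ∷ y) =
  gmap (a ∷_) (Adjacent-∷ a) (Hamming-connected x y) ◅◅ lastStep (change-head a b y)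
  where
  lastStep : a ∷ y ≡ b ∷ y ⊎ Adjacent (a ∷ y) (b ∷ y) → Star Adjacent (a ∷ y) (b ∷ y)
  lastStep (inj₁ a∷y≡b∷y) = subst (Star Adjacent (a ∷ y)) a∷y≡b∷y ε
  lastStep (inj₂ adj)     = adj ◅ ε

-- Signs and strong nodal domains

HasSign : Sign → ℤ → Set
HasSign Sign.+ v = 0ℤ ℤ.< v
HasSign Sign.- v = v ℤ.< 0ℤ

HasSign⇒≢0 : ∀ s {v} → HasSign s v → v ≢ 0ℤ
HasSign⇒≢0 Sign.+ 0<v refl = <-irrefl refl 0<v
HasSign⇒≢0 Sign.- v<0 refl = <-irrefl refl v<0

≢0⇒HasSign : ∀ {v} → v ≢ 0ℤ → ∃ λ s → HasSign s v
≢0⇒HasSign {+ zero}    v≢0 = ⊥-elim (v≢0 refl)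
≢0⇒HasSign {+ suc _}   _   = Sign.+ , +<+ (s≤s z≤n)
≢0⇒HasSign { -[1+ _ ]} _   = Sign.- , -<+

HasSign-unique : ∀ s s′ {v} → HasSign s v → HasSign s′ v → s ≡ s′
HasSign-unique Sign.+ Sign.+ _   _   = refl
HasSign-unique Sign.+ Sign.- 0<v v<0 = ⊥-elim (<-asym 0<v v<0)
HasSign-unique Sign.- Sign.+ v<0 0<v = ⊥-elim (<-asym 0<v v<0)
HasSign-unique Sign.- Sign.- _   _   = refl

HasSign⇒SameSign : ∀ s {a b} → HasSign s a → HasSign s b → SameSign a b
HasSign⇒SameSign Sign.+ 0<a 0<b = inj₁ (0<a , 0<b)
HasSign⇒SameSign Sign.- a<0 b<0 = inj₂ (a<0 , b<0)

SameSign-sym : ∀ {a b} → SameSign a b → SameSign b a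
SameSign-sym = Sum.map swap swap

SameSign-transfer : ∀ s {a b} → SameSign a b → HasSign s a → HasSign s b
SameSign-transfer Sign.+ (inj₁ (_ , 0<b)) _   = 0<b
SameSign-transfer Sign.+ (inj₂ (a<0 , _)) 0<a = ⊥-elim (<-asym 0<a a<0)
SameSign-transfer Sign.- (inj₁ (0<a , _)) a<0 = ⊥-elim (<-asym 0<a a<0)
SameSign-transfer Sign.- (inj₂ (_ , b<0)) _   = b<0

record SignStep {n q} (f : Vertex n q → ℤ) (x y : Vertex n q) : Set where
  constructor signStep
  field
    adjacent  : Adjacent x y
    same-sign : SameSign (f x) (f y)

SignStep-sym : ∀ {n q} {f : Vertex n q → ℤ} → Symmetric (SignStep f)
SignStep-sym {x = x} {y} (signStep adj same) = signStep (Adjacent-sym x y adj) (SameSign-sym same)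

Star⇒SameDomain : ∀ {n q} {f : Vertex n q → ℤ} {x y} →
                  Star (SignStep f) x y → f y ≢ 0ℤ → SameDomain f x y
Star⇒SameDomain ε                        fy≢0 = here fy≢0
Star⇒SameDomain (signStep adj same ◅ walk) fy≢0 = step adj same (Star⇒SameDomain walk fy≢0)

SameDomain-sign : ∀ {n q} {f : Vertex n q → ℤ} {x y} s →
                  SameDomain f x y → HasSign s (f x) → HasSign s (f y)
SameDomain-sign s (here _)           h = h
SameDomain-sign s (step _ same walk) h = SameDomain-sign s walk (SameSign-transfer s same h)

connected-signs⇒SND≡2 : ∀ {n q} (f : Vertex n q → ℤ) (root : Sign → Vertex n q) →
  (∀ s → HasSign s (f (root s))) →
  (∀ s x → HasSign s (f x) → Star (SignStep f) x (root s)) →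
  SNDIs f 2
connected-signs⇒SND≡2 {n} {q} f root root-sign reach = r , r≢0 , distinct , cover
  where
  r : Fin 2 → Vertex n q
  r 0F = root Sign.+
  r 1F = root Sign.-
  r≢0 : ∀ j → f (r j) ≢ 0ℤ
  r≢0 0F = HasSign⇒≢0 Sign.+ (root-sign Sign.+)
  r≢0 1F = HasSign⇒≢0 Sign.- (root-sign Sign.-)
  distinct : ∀ j j′ → SameDomain f (r j) (r j′) → j ≡ j′
  distinct 0F 0F _ = refl
  distinct 1F 1F _ = refl
  distinct 0F 1F d
    with HasSign-unique Sign.+ Sign.- (SameDomain-sign Sign.+ d (root-sign Sign.+)) (root-sign Sign.-)
  ... | ()
  distinct 1F 0F d
    with HasSign-unique Sign.- Sign.+ (SameDomain-sign Sign.- d (root-sign Sign.-)) (root-sign Sign.+)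
  ... | ()
  cover : ∀ x → f x ≢ 0ℤ → ∃ λ j → SameDomain f x (r j)
  cover x fx≢0 with ≢0⇒HasSign fx≢0
  ... | Sign.+ , h = 0F , Star⇒SameDomain (reach Sign.+ x h) (r≢0 0F)
  ... | Sign.- , h = 1F , Star⇒SameDomain (reach Sign.- x h) (r≢0 1F)

-- Two plane waves with two strong nodal domains

u : Fin 3 → ℤ
u 0F = + 2
u 1F = -1ℤ
u 2F = -1ℤ

classify : Fin 3 → Fin 3 → Sign
classify 0F      _       = Sign.+
classify (suc _) 0F      = Sign.+
classify (suc _) (suc _) = Sign.-

hasSign? : ∀ s v → Dec (HasSign s v)
hasSign? Sign.+ v = 0ℤ <? v
hasSign? Sign.- v = v <? 0ℤ

u-sign : ∀ p q → HasSign (classify p q) (u p + u q)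
u-sign = toWitness {a? = all? λ p → all? λ q → hasSign? (classify p q) (u p + u q)} _

centre : Sign → Fin 3
centre Sign.+ = 0F
centre Sign.- = 1F

Bridge : Sign → Set
Bridge s = ∀ τ τ′ → ∃₂ λ a b → classify (a ⊕ τ) (b ⊕ τ) ≡ s × classify (a ⊕ τ′) (b ⊕ τ′) ≡ s

bridge? : ∀ s → Dec (Bridge s)
bridge? s = all? λ τ → all? λ τ′ → any? λ a → any? λ b →
  (classify (a ⊕ τ) (b ⊕ τ) Sign.≟ s) ×-dec (classify (a ⊕ τ′) (b ⊕ τ′) Sign.≟ s)

-- For + one may take a = ⊖ τ and b = ⊖ τ′; for − any a = b outside {⊖ τ, ⊖ τ′}.
bridge : ∀ s → Bridge s
bridge Sign.+ = toWitness {a? = bridge? Sign.+} _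
bridge Sign.- = toWitness {a? = bridge? Sign.-} _

twoWaves : ∀ {m} → (Vertex m 3 → Fin 3) → Vertex (2 ℕ.+ m) 3 → ℤ
twoWaves t (a ∷ b ∷ z) = u (a ⊕ t z) + u (b ⊕ t z)

module _ {m : ℕ} (t : Vertex m 3 → Fin 3) where

  signAt : Vertex (2 ℕ.+ m) 3 → Sign
  signAt (a ∷ b ∷ z) = classify (a ⊕ t z) (b ⊕ t z)

  twoWaves-sign : ∀ x → HasSign (signAt x) (twoWaves t x)
  twoWaves-sign (a ∷ b ∷ z) = u-sign (a ⊕ t z) (b ⊕ t z)

  _∼_ : Vertex (2 ℕ.+ m) 3 → Vertex (2 ℕ.+ m) 3 → Set
  _∼_ = Star (SignStep (twoWaves t))

  move : ∀ {x y} → x ≡ y ⊎ Adjacent x y → signAt x ≡ signAt y → x ∼ y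
  move         (inj₁ refl) _ = ε
  move {x} {y} (inj₂ adj)  e = signStep adj (HasSign⇒SameSign (signAt x) (twoWaves-sign x)
    (subst (λ s → HasSign s (twoWaves t y)) (sym e) (twoWaves-sign y))) ◅ ε

  fibre : Vertex m 3 → Fin 3 → Fin 3 → Vertex (2 ℕ.+ m) 3
  fibre z p q = p ⊖ t z ∷ q ⊖ t z ∷ z

  signAt-fibre : ∀ z p q → signAt (fibre z p q) ≡ classify p q
  signAt-fibre z p q = cong₂ classify (⊖-⊕-cancel p (t z)) (⊖-⊕-cancel q (t z))

  fibre-coordinates : ∀ a b z → fibre z (a ⊕ t z) (b ⊕ t z) ≡ a ∷ b ∷ z
  fibre-coordinates a b z = cong₂ (λ a b → a ∷ b ∷ z) (⊕-⊖-cancel a (t z)) (⊕-⊖-cancel b (t z))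

  move-first : ∀ z {p p′} q → classify p q ≡ classify p′ q → fibre z p q ∼ fibre z p′ q
  move-first z {p} {p′} q e = move (change-head (p ⊖ t z) (p′ ⊖ t z) (q ⊖ t z ∷ z))
    (trans (signAt-fibre z p q) (trans e (sym (signAt-fibre z p′ q))))

  move-second : ∀ z p {q q′} → classify p q ≡ classify p q′ → fibre z p q ∼ fibre z p q′
  move-second z p {q} {q′} e =
    move (Sum.map (cong (p ⊖ t z ∷_)) (Adjacent-∷ (p ⊖ t z)) (change-head (q ⊖ t z) (q′ ⊖ t z) z))
         (trans (signAt-fibre z p q) (trans e (sym (signAt-fibre z p q′))))

  to-centre : ∀ z p q → fibre z p q ∼ fibre z (centre (classify p q)) (centre (classify p q))
  to-centre z 0F      q       = move-second z 0F refl
  to-centre z (suc p) 0F      = move-first z 0F refl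
  to-centre z (suc p) (suc q) = move-first z {p′ = 1F} (suc q) refl ◅◅ move-second z 1F refl

  within-fibre : ∀ {a b a′ b′ z} → signAt (a ∷ b ∷ z) ≡ signAt (a′ ∷ b′ ∷ z) →
                 (a ∷ b ∷ z) ∼ (a′ ∷ b′ ∷ z)
  within-fibre {a} {b} {a′} {b′} {z} e =
    subst₂ _∼_ (fibre-coordinates a b z) (fibre-coordinates a′ b′ z)
      (to-centre z p q ◅◅ subst (λ s → fibre z (centre s) (centre s) ∼ fibre z p′ q′) (sym e)
                                (reverse SignStep-sym (to-centre z p′ q′)))
    where
    p q p′ q′ : Fin 3
    p  = a ⊕ t z
    q  = b ⊕ t z
    p′ = a′ ⊕ t z
    q′ = b′ ⊕ t z

  transport : ∀ {z z′} → Star Adjacent z z′ → ∀ a b →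
    ∃₂ λ a′ b′ → signAt (a′ ∷ b′ ∷ z′) ≡ signAt (a ∷ b ∷ z) × (a ∷ b ∷ z) ∼ (a′ ∷ b′ ∷ z′)
  transport ε a b = a , b , refl , ε
  transport {z} (_◅_ {j = z₁} adj path) a b with bridge (signAt (a ∷ b ∷ z)) (t z) (t z₁)
  ... | a₁ , b₁ , at-z , at-z₁ with transport path a₁ b₁
  ... | a′ , b′ , same , walk =
    a′ , b′ , trans same at-z₁ ,
    within-fibre (sym at-z)
      ◅◅ move (inj₂ (Adjacent-∷ a₁ (Adjacent-∷ b₁ adj))) (trans at-z (sym at-z₁))
      ◅◅ walk

  root : Sign → Vertex (2 ℕ.+ m) 3
  root s = fibre (replicate m 0F) (centre s) (centre s)

  signAt-root : ∀ s → signAt (root s) ≡ s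
  signAt-root Sign.+ = signAt-fibre (replicate m 0F) 0F 0F
  signAt-root Sign.- = signAt-fibre (replicate m 0F) 1F 1F

  reach-root : ∀ s x → HasSign s (twoWaves t x) → x ∼ root s
  reach-root s (a ∷ b ∷ z) h with transport (Hamming-connected z (replicate m 0F)) a b
  ... | a′ , b′ , same , walk = walk ◅◅ within-fibre
    (trans same (trans (HasSign-unique _ s (twoWaves-sign (a ∷ b ∷ z)) h) (sym (signAt-root s))))

  twoWaves-SND≡2 : SNDIs (twoWaves t) 2
  twoWaves-SND≡2 = connected-signs⇒SND≡2 (twoWaves t) root
    (λ s → subst (λ s′ → HasSign s′ (twoWaves t (root s))) (signAt-root s) (twoWaves-sign (root s)))
    reach-root

twoWaves-eigen : ∀ {m} (M : Subset m) x →
  laplacian (twoWaves (coordinateSum M)) x ≡ + (3 * suc ∣ M ∣) ℤ.* twoWaves (coordinateSum M) x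
twoWaves-eigen {m} M x@(_ ∷ _ ∷ _) = begin
  laplacian (twoWaves (coordinateSum M)) x
    ≡⟨ laplacian-cong asWaves x ⟩
  laplacian (λ y → wave₁ y + wave₂ y) x
    ≡⟨ laplacian-+ wave₁ wave₂ x ⟩
  laplacian wave₁ x + laplacian wave₂ x
    ≡⟨ cong₂ _+_ (planeWave-eigen S₁ u refl x) (planeWave-eigen S₂ u refl x) ⟩
  λ′ ℤ.* wave₁ x + λ′ ℤ.* wave₂ x
    ≡⟨ sym (*-distribˡ-+ λ′ (wave₁ x) (wave₂ x)) ⟩
  λ′ ℤ.* twoWaves (coordinateSum M) x ∎
  where
  open ≡-Reasoning
  S₁ S₂ : Subset (2 ℕ.+ m)
  S₁ = inside ∷ outside ∷ M
  S₂ = outside ∷ inside ∷ M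
  wave₁ wave₂ : Vertex (2 ℕ.+ m) 3 → ℤ
  wave₁ = u ∘ coordinateSum S₁
  wave₂ = u ∘ coordinateSum S₂
  λ′ : ℤ
  λ′ = + (3 * suc ∣ M ∣)
  asWaves : ∀ y → twoWaves (coordinateSum M) y ≡ wave₁ y + wave₂ y
  asWaves (_ ∷ _ ∷ _) = refl

leading : ∀ k {d} → Subset (k ℕ.+ d)
leading zero    = ⊥
leading (suc k) = inside ∷ leading k

∣leading∣ : ∀ k {d} → ∣ leading k {d} ∣ ≡ k
∣leading∣ zero    {d} = ∣⊥∣≡0 d
∣leading∣ (suc k)     = cong suc (∣leading∣ k)

theorem6 : (n : ℕ) → 2 ≤ n → (i : ℕ) → 1 ≤ i → i < n →
    Σ (Vertex n 3 → ℤ) λ f → IsEigenfunction n 3 (+ (3 * i)) f × SNDIs f 2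
theorem6 n _ (suc k) _ i<n with m≤n⇒∃[o]m+o≡n i<n
... | d , refl = f , ((x₀ , HasSign⇒≢0 _ (twoWaves-sign t x₀)) , eigen) , twoWaves-SND≡2 t
  where
  t : Vertex (k ℕ.+ d) 3 → Fin 3
  t = coordinateSum (leading k)
  f : Vertex n 3 → ℤ
  f = twoWaves t
  x₀ : Vertex n 3
  x₀ = replicate n 0F
  eigen : ∀ x → + (3 * suc k) ℤ.* f x ≡ laplacian f x
  eigen x =
    sym (trans (twoWaves-eigen (leading k) x) (cong (λ j → + (3 * suc j) ℤ.* f x) (∣leading∣ k)))
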